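{- Let $G$ be a finite simple graph with a clique vertex-partition $\Pi$, and let $t\ge 2$ be an integer. Then $\mathrm{CF}_t(G(\Pi,t))$ is $(t-2)$-decomposable. Consequently, $\mathrm{CF}_t(G(\Pi,t))$ is shellable.
   Context: A clique vertex-partition of $G$ is a collection $\Pi=\{W_1,\dots,W_p\}$ of pairwise disjoint (possibly empty) vertex sets each inducing a clique, whose union is $V(G)$. The $t$-clique whiskering $G(\Pi,t)$ is obtained from $G$ by adding, for each $i$, $t-1$ new distinct vertices $x_{i,1},\dots,x_{i,t-1}$ and making $W_i\cup\{x_{i,1},\dots,x_{i,t-1}\}$ a clique; no other edges are added. $\mathrm{CF}_t(\cdot)$ is the simplicial complex on the vertex set whose faces are the vertex subsets inducing no $t$-clique. For a simplicial complex $\Delta$ on $V$ and face $F$: $\operatorname{link}_\Delta(F)=\{F':F'\cap F=\emptyset,F'\cup F\in\Delta\}$, $\Delta\setminus F=\{H\in\Delta:H\cap F=\emptyset\}$, $\dim F=|F|-1$. A face $\sigma$ is a shedding face if for every $\tau\in\Delta$ with $\sigma\subseteq\tau$ and every $v\in\sigma$ there is $w\in V\setminus\tau$ with $(\tau\cup\{w\})\setminus\{v\}\in\Delta$. $\Delta$ is $k$-decomposable if it is a simplex (including $\emptyset$, $\{\emptyset\}$) or has a shedding face $\sigma$ with $\dim\sigma\le k$ such that $\Delta\setminus\sigma$ and $\operatorname{link}_\Delta(\sigma)$ are $k$-decomposable. $\Delta$ is shellable if its facets admit an order $F_1,\dots,F_s$ such that for all $i<j$ there exist $v\in F_j\setminus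 F_i$ and $\ell<j$ with $F_j\setminus F_\ell=\{v\}$. -}

module Defs where

open import Data.Fin using (Fin; splitAt; remQuot; _<_; _≟_)
open import Data.Fin.Properties using (all?)
open import Data.Fin.Subset
open import Data.Fin.Subset.Properties
  using (_∈?_; _⊆?_; anySubset?; nonempty?; ⊆-trans; x∈p∩q⁺; x∈p∩q⁻; x∈p∪q⁺; x∈p∪q⁻)
open import Data.Integer as ℤ using (ℤ; +_)
open import Data.Nat as ℕ using (ℕ; _+_; _*_; _∸_)
open import Data.Product using (∃-syntax; _×_; _,_)
open import Data.Sum as Sum using (_⊎_; inj₁; inj₂)
open import Function using (_∘_; id)
open import Function.Bundles using (_⇔_)
open import Relation.Binary.Core using (Rel)
open import Relation.Binary.Definitions using (Symmetric; Decidable)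
open import Relation.Binary.PropositionalEquality using (_≡_; _≢_; refl; sym)
open import Relation.Nullary using (¬_)
open import Relation.Nullary.Decidable using (¬?; _×-dec_; _→-dec_)
open import Relation.Unary as U using (Pred)
open import Level using (0ℓ)

record SimpleGraph (n : ℕ) : Set₁ where
  field
    _~_     : Rel (Fin n) 0ℓ
    ~-sym   : Symmetric _~_
    ~-irrefl : ∀ v → ¬ (v ~ v)
    _~?_    : Decidable _~_

module _ {n : ℕ} (G : SimpleGraph n) where
  open SimpleGraph G

  IsClique : Subset n → Set
  IsClique K = ∀ u v → u ∈ K → v ∈ K → u ≢ v → u ~ v

  isClique? : U.Decidable IsClique
  isClique? K = all? λ u → all? λ v →
    (u ∈? K) →-dec ((v ∈? K) →-dec (¬? (u ≟ v) →-dec (u ~? v)))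

-- Blocks may be empty, so a partition is an indexed family and p is not
-- determined by (or bounded by) n.
record CliquePartition {n : ℕ} (G : SimpleGraph n) (p : ℕ) : Set where
  field
    block    : Fin p → Subset n
    disjoint : ∀ i j → i ≢ j → Empty (block i ∩ block j)
    covers   : ∀ v → ∃[ i ] v ∈ block i
    clique   : ∀ i → IsClique G (block i)

module _ {n : ℕ} (G : SimpleGraph n) {p : ℕ} (Π : CliquePartition G p) (t : ℕ) where
  open SimpleGraph G
  open CliquePartition Π

  -- inj₁ v is an original vertex, inj₂ (i , a) is the new vertex x_{i,a}.
  WhiskerVertex : Set
  WhiskerVertex = Fin n ⊎ (Fin p × Fin (t ∸ 1))

  -- Two original vertices in the same block are already adjacent in G, so
  -- making W_i ∪ {x_{i,1}, …, x_{i,t-1}} a clique adds no edge between them.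
  WhiskerAdj : Rel WhiskerVertex 0ℓ
  WhiskerAdj (inj₁ u)       (inj₁ v)       = u ~ v
  WhiskerAdj (inj₁ u)       (inj₂ (j , _)) = u ∈ block j
  WhiskerAdj (inj₂ (i , _)) (inj₁ v)       = v ∈ block i
  WhiskerAdj (inj₂ (i , a)) (inj₂ (j , b)) = i ≡ j × a ≢ b

  whiskerAdj-sym : Symmetric WhiskerAdj
  whiskerAdj-sym {inj₁ _} {inj₁ _} e         = ~-sym e
  whiskerAdj-sym {inj₁ _} {inj₂ _} e         = e
  whiskerAdj-sym {inj₂ _} {inj₁ _} e         = e
  whiskerAdj-sym {inj₂ _} {inj₂ _} (e , a≢b) = sym e , a≢b ∘ sym

  whiskerAdj-irrefl : ∀ x → ¬ WhiskerAdj x x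
  whiskerAdj-irrefl (inj₁ v) e         = ~-irrefl v e
  whiskerAdj-irrefl (inj₂ _) (_ , a≢a) = a≢a refl

  whiskerAdj? : Decidable WhiskerAdj
  whiskerAdj? (inj₁ u)       (inj₁ v)       = u ~? v
  whiskerAdj? (inj₁ u)       (inj₂ (j , _)) = u ∈? block j
  whiskerAdj? (inj₂ (i , _)) (inj₁ v)       = v ∈? block i
  whiskerAdj? (inj₂ (i , a)) (inj₂ (j , b)) = (i ≟ j) ×-dec ¬? (a ≟ b)

  whiskerVertex : Fin (n + p * (t ∸ 1)) → WhiskerVertex
  whiskerVertex x = Sum.map₂ (remQuot (t ∸ 1)) (splitAt n x)

  whiskering : SimpleGraph (n + p * (t ∸ 1))
  whiskering = record
    { _~_      = λ x y → WhiskerAdj (whiskerVertex x) (whiskerVertex y)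
    ; ~-sym    = λ {x} {y} → whiskerAdj-sym {whiskerVertex x} {whiskerVertex y}
    ; ~-irrefl = λ x → whiskerAdj-irrefl (whiskerVertex x)
    ; _~?_     = λ x y → whiskerAdj? (whiskerVertex x) (whiskerVertex y)
    }

-- A complex on the ambient set Fin n: elements of Fin n need not be vertices,
-- and the complex with no faces at all is allowed.
record SimplicialComplex (n : ℕ) : Set₁ where
  field
    Face  : Pred (Subset n) 0ℓ
    face? : U.Decidable Face
    down  : ∀ {F H} → H ⊆ F → Face F → Face H

open SimplicialComplex

CF : ∀ {n} → ℕ → SimpleGraph n → SimplicialComplex n
CF t G = record
  { Face  = λ F → ¬ (∃[ K ] (K ⊆ F × IsClique G K × ∣ K ∣ ≡ t))
  ; face? = λ F → ¬? (anySubset? λ K →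
              (K ⊆? F) ×-dec (isClique? G K ×-dec (∣ K ∣ ℕ.≟ t)))
  ; down  = λ H⊆F ¬c (K , K⊆H , c) → ¬c (K , ⊆-trans K⊆H H⊆F , c)
  }

module _ {n : ℕ} where

  ∩-Empty-⊆ : ∀ {H F} (σ : Subset n) → H ⊆ F → Empty (F ∩ σ) → Empty (H ∩ σ)
  ∩-Empty-⊆ {H} σ H⊆F e (x , x∈) with x∈p∩q⁻ H σ x∈
  ... | x∈H , x∈σ = e (x , x∈p∩q⁺ (H⊆F x∈H , x∈σ))

  ∪-monoˡ-⊆ : ∀ {H F} (σ : Subset n) → H ⊆ F → H ∪ σ ⊆ F ∪ σ
  ∪-monoˡ-⊆ {H} σ H⊆F x∈ = x∈p∪q⁺ (Sum.map H⊆F id (x∈p∪q⁻ H σ x∈))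

  link : SimplicialComplex n → Subset n → SimplicialComplex n
  link Δ σ = record
    { Face  = λ H → Empty (H ∩ σ) × Face Δ (H ∪ σ)
    ; face? = λ H → ¬? (nonempty? (H ∩ σ)) ×-dec face? Δ (H ∪ σ)
    ; down  = λ H⊆F (e , f) → ∩-Empty-⊆ σ H⊆F e , down Δ (∪-monoˡ-⊆ σ H⊆F) f
    }

  -- This removes every vertex of σ, not only the faces that contain σ.
  _∖_ : SimplicialComplex n → Subset n → SimplicialComplex n
  Δ ∖ σ = record
    { Face  = λ H → Face Δ H × Empty (H ∩ σ)
    ; face? = λ H → face? Δ H ×-dec ¬? (nonempty? (H ∩ σ))
    ; down  = λ H⊆F (f , e) → down Δ H⊆F f , ∩-Empty-⊆ σ H⊆F e
    }

  dim : Subset n → ℤ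
  dim F = + ∣ F ∣ ℤ.- + 1

  -- The first summand is the complex ∅; the second contains {∅} (take F = ⊥).
  IsSimplex : SimplicialComplex n → Set
  IsSimplex Δ = (∀ H → ¬ Face Δ H) ⊎ (∃[ F ] ∀ H → Face Δ H ⇔ H ⊆ F)

  -- w ranges over the ambient set; since (τ ∪ {w}) ∖ {v} is a face and
  -- w ∉ τ, any such w is automatically a vertex of Δ.
  IsSheddingFace : SimplicialComplex n → Subset n → Set
  IsSheddingFace Δ σ = Face Δ σ ×
    (∀ τ → Face Δ τ → σ ⊆ τ → ∀ v → v ∈ σ →
      ∃[ w ] (w ∉ τ × Face Δ ((τ ∪ ⁅ w ⁆) - v)))

  data Decomposable (k : ℕ) (Δ : SimplicialComplex n) : Set where
    simplex : IsSimplex Δ → Decomposable k Δ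
    shed    : ∀ σ → IsSheddingFace Δ σ → dim σ ℤ.≤ + k →
              Decomposable k (Δ ∖ σ) → Decomposable k (link Δ σ) →
              Decomposable k Δ

  IsFacet : SimplicialComplex n → Subset n → Set
  IsFacet Δ F = Face Δ F × (∀ H → Face Δ H → F ⊆ H → F ≡ H)

  record Shellable (Δ : SimplicialComplex n) : Set where
    field
      size      : ℕ
      facet     : Fin size → Subset n
      isFacet   : ∀ i → IsFacet Δ (facet i)
      injective : ∀ i j → facet i ≡ facet j → i ≡ j
      complete  : ∀ F → IsFacet Δ F → ∃[ i ] facet i ≡ F
      shelling  : ∀ i j → i < j →
        ∃[ v ] ∃[ ℓ ] (v ∈ facet j × v ∉ facet i × ℓ < j ×
                       facet j ─ facet ℓ ≡ ⁅ v ⁆)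

-- The complex is even vertex decomposable, which is 0-decomposability, and this
-- gives shellability by listing the facets of the deletion before those of the
-- link. Treat the original vertices first and the new ones afterwards. A vertex
-- v of a face that lies in the block W_i can always be replaced by a new vertex
-- w = x_{i,a} outside the face: all cliques through w lie in W_i ∪ {x_{i,1}, …},
-- which meets the face in at most t − 1 vertices before and after the exchange.
-- If v is itself new, then a later w outside the face exists unless the vertices
-- of the block linked so far, together with all its remaining ones, number less
-- than t; but then v lies in no t-clique any more and is a cone point.

module Submission where

open import Defs
open import Data.Empty using (⊥-elim)
open import Data.Fin as Fin using (Fin; zero; suc; toℕ; fromℕ<; _↑ˡ_; _↑ʳ_; splitAt)
open import Data.Fin.Properties as Fin using (any?)
open import Data.Fin.Subset
open import Data.Fin.Subset.Properties
open import Data.Integer as ℤ using (+_)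
open import Data.Nat as ℕ using (ℕ; zero; suc; _+_; _*_; _∸_; _≤_; _<_; z≤n; s≤s; z<s)
open import Data.Nat.Properties
open import Data.Product using (∃-syntax; _×_; _,_; proj₁; proj₂)
open import Data.Sum using (_⊎_; inj₁; inj₂)
open import Data.Vec using (_∷_; tabulate; there)
open import Data.Vec.Functional as F using ()
open import Data.Vec.Functional.Properties using (lookup-++ˡ; lookup-++ʳ)
open import Data.Vec.Properties using (lookup∘tabulate; []=⇒lookup; lookup⇒[]=)
open import Function using (_∘_)
open import Function.Bundles using (_⇔_; mk⇔; Equivalence)
open import Relation.Binary.PropositionalEquality
open import Relation.Nullary using (¬_; Dec; yes; no; does)
open import Relation.Nullary.Decidable using (_×-dec_; _→-dec_; ¬?; dec-true; decidable-stable)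
import Relation.Unary as U

open SimplicialComplex

private
  variable
    n : ℕ

-- Subsets of a finite set

x∈p─q⇒x∉q : ∀ (p q : Subset n) {x} → x ∈ p ─ q → x ∉ q
x∈p─q⇒x∉q (_ ∷ p) (inside  ∷ q) (there x∈) (there x∈q) = x∈p─q⇒x∉q p q x∈ x∈q
x∈p─q⇒x∉q (_ ∷ p) (outside ∷ q) (there x∈) (there x∈q) = x∈p─q⇒x∉q p q x∈ x∈q

x∈p-y⁻ : ∀ (p : Subset n) {x y} → x ∈ p - y → x ∈ p × x ≢ y
x∈p-y⁻ p {x} {y} x∈ =
  p─q⊆p p ⁅ y ⁆ x∈ , λ { refl → x∈p─q⇒x∉q p ⁅ y ⁆ x∈ (x∈⁅x⁆ y) }

x∉p-x : ∀ (p : Subset n) {x} → x ∉ p - x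
x∉p-x p x∈ = proj₂ (x∈p-y⁻ p x∈) refl

x∈p∪⁅x⁆ : ∀ (p : Subset n) {x} → x ∈ p ∪ ⁅ x ⁆
x∈p∪⁅x⁆ p {x} = x∈p∪q⁺ (inj₂ (x∈⁅x⁆ x))

x∈p∪⁅y⁆⁻ : ∀ (p : Subset n) {x y} → x ∈ p ∪ ⁅ y ⁆ → x ∈ p ⊎ x ≡ y
x∈p∪⁅y⁆⁻ p {x} {y} x∈ with x∈p∪q⁻ p ⁅ y ⁆ x∈
... | inj₁ x∈p = inj₁ x∈p
... | inj₂ x∈y = inj₂ (x∈⁅y⁆⇒x≡y y x∈y)

x∈p⇒⁅x⁆⊆p : ∀ {p : Subset n} {x} → x ∈ p → ⁅ x ⁆ ⊆ p
x∈p⇒⁅x⁆⊆p {p = p} {x} x∈p y∈ = subst (_∈ p) (sym (x∈⁅y⁆⇒x≡y x y∈)) x∈p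

∪-lub : ∀ {p q r : Subset n} → p ⊆ r → q ⊆ r → p ∪ q ⊆ r
∪-lub {p = p} {q} p⊆r q⊆r x∈ with x∈p∪q⁻ p q x∈
... | inj₁ x∈p = p⊆r x∈p
... | inj₂ x∈q = q⊆r x∈q

∉⇒Empty-∩ : ∀ {p : Subset n} {x} → x ∉ p → Empty (p ∩ ⁅ x ⁆)
∉⇒Empty-∩ {p = p} {x} x∉p (y , y∈) with x∈p∩q⁻ p ⁅ x ⁆ y∈
... | y∈p , y∈x = x∉p (subst (_∈ p) (x∈⁅y⁆⇒x≡y x y∈x) y∈p)

Empty-∩⇒∉ : ∀ {p : Subset n} {x} → Empty (p ∩ ⁅ x ⁆) → x ∉ p
Empty-∩⇒∉ {x = x} e x∈p = e (x , x∈p∩q⁺ (x∈p , x∈⁅x⁆ x))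

∣p∪⁅x⁆∣≤1+∣p∣ : ∀ (p : Subset n) x → ∣ p ∪ ⁅ x ⁆ ∣ ≤ suc ∣ p ∣
∣p∪⁅x⁆∣≤1+∣p∣ (inside  ∷ p) zero    rewrite ∪-identityʳ p = n≤1+n _
∣p∪⁅x⁆∣≤1+∣p∣ (outside ∷ p) zero    rewrite ∪-identityʳ p = ≤-refl
∣p∪⁅x⁆∣≤1+∣p∣ (inside  ∷ p) (suc x) = s≤s (∣p∪⁅x⁆∣≤1+∣p∣ p x)
∣p∪⁅x⁆∣≤1+∣p∣ (outside ∷ p) (suc x) = ∣p∪⁅x⁆∣≤1+∣p∣ p x

injection⇒≤∣p∣ : ∀ {m} (p : Subset n) (f : Fin m → Fin n) →
                (∀ i j → f i ≡ f j → i ≡ j) → (∀ i → f i ∈ p) → m ≤ ∣ p ∣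
injection⇒≤∣p∣ {m = zero}  p f inj f∈p = z≤n
injection⇒≤∣p∣ {m = suc m} p f inj f∈p = ≤-trans
  (s≤s (injection⇒≤∣p∣ (p - f zero) (f ∘ suc)
    (λ i j eq → Fin.suc-injective (inj _ _ eq))
    (λ i → x∈p∧x≢y⇒x∈p-y (f∈p (suc i)) λ eq → Fin.0≢1+n (sym (inj _ _ eq)))))
  (x∈p⇒∣p-x∣<∣p∣ (f∈p zero))

shrink : ∀ (p : Subset n) {m} → m ≤ ∣ p ∣ → ∃[ q ] (q ⊆ p × ∣ q ∣ ≡ m)
shrink {n} p {zero} _ = ⊥ , ⊥⊆ , ∣⊥∣≡0 n
shrink (inside  ∷ p) {suc m} (s≤s le) with shrink p le
... | q , q⊆p , eq = inside ∷ q , in⊆in q⊆p , cong suc eq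
shrink (outside ∷ p) {suc m} le with shrink p le
... | q , q⊆p , eq = outside ∷ q , out⊆ q⊆p , eq

module _ {P : Fin n → Set} (P? : U.Decidable P) where

  subset : Subset n
  subset = tabulate (does ∘ P?)

  ∈-subset⁺ : ∀ {x} → P x → x ∈ subset
  ∈-subset⁺ {x} px = lookup⇒[]= x subset (trans (lookup∘tabulate _ x) (dec-true (P? x) px))

  ∈-subset⁻ : ∀ {x} → x ∈ subset → P x
  ∈-subset⁻ {x} x∈ with P? x | trans (sym (lookup∘tabulate (does ∘ P?) x)) ([]=⇒lookup x∈)
  ... | yes px | _ = px

-- Vertex decomposable complexes

data VertexDecomposable (Δ : SimplicialComplex n) : Set₁ where
  simplex : IsSimplex Δ → VertexDecomposable Δ
  shed    : ∀ v → IsSheddingFace Δ ⁅ v ⁆ →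
            VertexDecomposable (Δ ∖ ⁅ v ⁆) → VertexDecomposable (link Δ ⁅ v ⁆) →
            VertexDecomposable Δ

-- A single vertex has dimension 0, which is within the bound for every `k`.
vertexDecomposable⇒decomposable : ∀ {Δ : SimplicialComplex n} k →
                                  VertexDecomposable Δ → Decomposable k Δ
vertexDecomposable⇒decomposable k (simplex s) = simplex s
vertexDecomposable⇒decomposable k (shed v sh del lk) =
  shed ⁅ v ⁆ sh (subst (λ c → + c ℤ.- + 1 ℤ.≤ + k) (sym (∣⁅x⁆∣≡1 v)) (ℤ.+≤+ z≤n))
    (vertexDecomposable⇒decomposable k del) (vertexDecomposable⇒decomposable k lk)

-- Facets, and shellings from vertex decompositions

module _ (Δ : SimplicialComplex n) where

  -- Greedy extension: vertices are added one at a time while the result is a face. Once no single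
  -- vertex can be added, closure under subsets makes the face maximal. In `go`, `d` bounds the
  -- number of additions still possible.
  facet-above : ∀ F → Face Δ F → ∃[ H ] (F ⊆ H × IsFacet Δ H)
  facet-above F fF = go n F fF (m≤n+m n ∣ F ∣)
    where
    go : ∀ d F → Face Δ F → n ≤ ∣ F ∣ + d → ∃[ H ] (F ⊆ H × IsFacet Δ H)
    go d F fF bound
      with any? (λ w → ¬? (w ∈? F) ×-dec face? Δ (F ∪ ⁅ w ⁆))
    ... | no ¬w = F , ⊆-refl , fF , λ H fH F⊆H → ⊆-antisym F⊆H λ {x} x∈H →
            decidable-stable (x ∈? F) λ x∉F →
              ¬w (x , x∉F , down Δ (∪-lub F⊆H (x∈p⇒⁅x⁆⊆p x∈H)) fH)
    ... | yes (w , w∉F , fFw) = extend d bound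
      where
      F<Fw : ∣ F ∣ < ∣ F ∪ ⁅ w ⁆ ∣
      F<Fw = p⊂q⇒∣p∣<∣q∣ (p⊆p∪q ⁅ w ⁆ , w , x∈p∪⁅x⁆ F , w∉F)
      extend : ∀ d → n ≤ ∣ F ∣ + d → ∃[ H ] (F ⊆ H × IsFacet Δ H)
      extend zero bound = ⊥-elim (<-irrefl refl (≤-trans F<Fw
        (≤-trans (∣p∣≤n (F ∪ ⁅ w ⁆)) (subst (n ≤_) (+-identityʳ _) bound))))
      extend (suc d) bound
        with go d (F ∪ ⁅ w ⁆) fFw
               (≤-trans (subst (n ≤_) (+-suc _ d) bound) (+-monoˡ-≤ d F<Fw))
      ... | H , Fw⊆H , facetH = H , ⊆-trans (p⊆p∪q ⁅ w ⁆) Fw⊆H , facetH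

simplex⇒shellable : ∀ {Δ : SimplicialComplex n} → IsSimplex Δ → Shellable Δ
simplex⇒shellable (inj₁ ¬face) = record
  { size = 0 ; facet = λ () ; isFacet = λ () ; injective = λ ()
  ; complete = λ F (fF , _) → ⊥-elim (¬face F fF) ; shelling = λ () }
simplex⇒shellable (inj₂ (S , face⇔)) = record
  { size      = 1
  ; facet     = λ _ → S
  ; isFacet   = λ _ → fS , λ H fH S⊆H → ⊆-antisym S⊆H (Equivalence.to (face⇔ H) fH)
  ; injective = λ { zero zero _ → refl }
  ; complete  = λ F (fF , max) → zero , sym (max S fS (Equivalence.to (face⇔ F) fF))
  ; shelling  = λ { zero zero () }
  }
  where fS = Equivalence.from (face⇔ S) ⊆-refl

module _ {Δ : SimplicialComplex n} {v : Fin n} (shedding : IsSheddingFace Δ ⁅ v ⁆) where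

  exchange : ∀ {τ} → Face Δ τ → v ∈ τ → ∃[ w ] (w ∉ τ × Face Δ ((τ ∪ ⁅ w ⁆) - v))
  exchange fτ v∈τ = proj₂ shedding _ fτ (x∈p⇒⁅x⁆⊆p v∈τ) v (x∈⁅x⁆ v)

  -- This is where shedding enters. If a face `H` above `F` contained `v`, exchanging `v` for some
  -- `w` outside `H` would give a face of the deletion that contains `F` and also `w`, against the
  -- maximality of `F` there.
  deletion-facet : ∀ {F} → IsFacet (Δ ∖ ⁅ v ⁆) F → IsFacet Δ F
  deletion-facet {F} ((fF , e) , max) = fF , λ H fH F⊆H → max H (fH , ∉⇒Empty-∩ (v∉ H fH F⊆H)) F⊆H
    where
    v∉F = Empty-∩⇒∉ e
    v∉ : ∀ H → Face Δ H → F ⊆ H → v ∉ H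
    v∉ H fH F⊆H v∈H with exchange fH v∈H
    ... | w , w∉H , fH′ = w∉H (F⊆H (subst (w ∈_) (sym F≡H′) w∈H′))
      where
      H′ = (H ∪ ⁅ w ⁆) - v
      w∈H′ : w ∈ H′
      w∈H′ = x∈p∧x≢y⇒x∈p-y (x∈p∪⁅x⁆ H) λ { refl → w∉H v∈H }
      F≡H′ : F ≡ H′
      F≡H′ = max H′ (fH′ , ∉⇒Empty-∩ (x∉p-x (H ∪ ⁅ w ⁆)))
        λ x∈F → x∈p∧x≢y⇒x∈p-y (p⊆p∪q ⁅ w ⁆ (F⊆H x∈F)) λ { refl → v∉F x∈F }

x∈p⇒p-x∪⁅x⁆≡p : ∀ {p : Subset n} {x} → x ∈ p → (p - x) ∪ ⁅ x ⁆ ≡ p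
x∈p⇒p-x∪⁅x⁆≡p {p = p} {x} x∈p = ⊆-antisym
  (∪-lub (p─q⊆p p ⁅ x ⁆) (x∈p⇒⁅x⁆⊆p x∈p)) λ {y} y∈p → restore y y∈p
  where
  restore : ∀ y → y ∈ p → y ∈ (p - x) ∪ ⁅ x ⁆
  restore y y∈p with y Fin.≟ x
  ... | yes refl = x∈p∪⁅x⁆ (p - x)
  ... | no  y≢x  = p⊆p∪q ⁅ x ⁆ (x∈p∧x≢y⇒x∈p-y y∈p y≢x)

∪⁅x⁆-cancel-⊆ : ∀ {p q : Subset n} {x} → x ∉ p → p ∪ ⁅ x ⁆ ⊆ q ∪ ⁅ x ⁆ → p ⊆ q
∪⁅x⁆-cancel-⊆ {q = q} {x} x∉p sub y∈p with x∈p∪⁅y⁆⁻ q (sub (p⊆p∪q ⁅ x ⁆ y∈p))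
... | inj₁ y∈q  = y∈q
... | inj₂ refl = ⊥-elim (x∉p y∈p)

∪⁅x⁆-─-cancel : ∀ {p q : Subset n} {x} → x ∉ p → (p ∪ ⁅ x ⁆) ─ (q ∪ ⁅ x ⁆) ≡ p ─ q
∪⁅x⁆-─-cancel {p = p} {q} {x} x∉p = ⊆-antisym l r
  where
  l : (p ∪ ⁅ x ⁆) ─ (q ∪ ⁅ x ⁆) ⊆ p ─ q
  l y∈ with x∈p∪⁅y⁆⁻ p (p─q⊆p (p ∪ ⁅ x ⁆) (q ∪ ⁅ x ⁆) y∈)
  ... | inj₁ y∈p  = x∈p∧x∉q⇒x∈p─q y∈p
        (x∈p─q⇒x∉q (p ∪ ⁅ x ⁆) (q ∪ ⁅ x ⁆) y∈ ∘ p⊆p∪q ⁅ x ⁆)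
  ... | inj₂ refl = ⊥-elim (x∈p─q⇒x∉q (p ∪ ⁅ x ⁆) (q ∪ ⁅ x ⁆) y∈ (x∈p∪⁅x⁆ q))
  r : p ─ q ⊆ (p ∪ ⁅ x ⁆) ─ (q ∪ ⁅ x ⁆)
  r {y} y∈ with p─q⊆p p q y∈
  ... | y∈p = x∈p∧x∉q⇒x∈p─q (p⊆p∪q ⁅ x ⁆ y∈p) λ y∈q → go (x∈p∪⁅y⁆⁻ q y∈q) y∈p
    where
    go : y ∈ q ⊎ y ≡ x → y ∉ p
    go (inj₁ y∈q)  _   = x∈p─q⇒x∉q p q y∈ y∈q
    go (inj₂ refl) x∈p = x∉p x∈p

data ↑View (m k : ℕ) : Fin (m + k) → Set where
  left  : ∀ a → ↑View m k (a ↑ˡ k)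
  right : ∀ b → ↑View m k (m ↑ʳ b)

↑view : ∀ m {k} (i : Fin (m + k)) → ↑View m k i
↑view m i with splitAt m i in eq
... | inj₁ a = subst (↑View m _) (Fin.splitAt⁻¹-↑ˡ eq) (left a)
... | inj₂ b = subst (↑View m _) (Fin.splitAt⁻¹-↑ʳ eq) (right b)

↑ˡ<↑ʳ : ∀ {m k} (a : Fin m) (b : Fin k) → a ↑ˡ k Fin.< m ↑ʳ b
↑ˡ<↑ʳ {m} {k} a b rewrite Fin.toℕ-↑ˡ a k | Fin.toℕ-↑ʳ m b =
  ≤-trans (Fin.toℕ<n a) (m≤m+n m (toℕ b))

module _ {Δ : SimplicialComplex n} {v : Fin n} (shedding : IsSheddingFace Δ ⁅ v ⁆)
         (del : Shellable (Δ ∖ ⁅ v ⁆)) (lk : Shellable (link Δ ⁅ v ⁆)) where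

  private
    module D = Shellable del
    module L = Shellable lk

    v∉D : ∀ a → v ∉ D.facet a
    v∉D a = Empty-∩⇒∉ (proj₂ (proj₁ (D.isFacet a)))

    v∉L : ∀ b → v ∉ L.facet b
    v∉L b = Empty-∩⇒∉ (proj₁ (proj₁ (L.isFacet b)))

    cone : Fin L.size → Subset n
    cone b = L.facet b ∪ ⁅ v ⁆

    facets : Fin (D.size + L.size) → Subset n
    facets = D.facet F.++ cone

    atˡ : ∀ a → facets (a ↑ˡ L.size) ≡ D.facet a
    atˡ = lookup-++ˡ D.facet cone

    atʳ : ∀ b → facets (D.size ↑ʳ b) ≡ cone b
    atʳ = lookup-++ʳ D.facet cone

    v∈cone : ∀ b → v ∈ cone b
    v∈cone b = x∈p∪⁅x⁆ (L.facet b)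

    -- A face above `cone b` contains `v`, and without `v` it is a face of the link, where
    -- `L.facet b` is maximal.
    cone-facet : ∀ b → IsFacet Δ (cone b)
    cone-facet b with L.isFacet b
    ... | (_ , fb) , max = fb , λ H fH b⊆H →
      let v∈H = b⊆H (v∈cone b)
          H-v∪v = x∈p⇒p-x∪⁅x⁆≡p v∈H in
      trans (cong (_∪ ⁅ v ⁆) (max (H - v)
        (∉⇒Empty-∩ (x∉p-x H) , subst (Face Δ) (sym H-v∪v) fH)
        λ x∈b → x∈p∧x≢y⇒x∈p-y (b⊆H (p⊆p∪q ⁅ v ⁆ x∈b)) λ { refl → v∉L b x∈b }))
      H-v∪v

    facets-facet : ∀ i → IsFacet Δ (facets i)
    facets-facet i with ↑view D.size i
    ... | left a  = subst (IsFacet Δ) (sym (atˡ a)) (deletion-facet {Δ = Δ} shedding (D.isFacet a))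
    ... | right b = subst (IsFacet Δ) (sym (atʳ b)) (cone-facet b)

    facets-injective : ∀ i j → facets i ≡ facets j → i ≡ j
    facets-injective i j eq with ↑view D.size i | ↑view D.size j
    ... | left a  | left a′  = cong (_↑ˡ L.size)
          (D.injective a a′ (trans (sym (atˡ a)) (trans eq (atˡ a′))))
    ... | left a  | right b  = ⊥-elim (v∉D a
          (subst (v ∈_) (trans (sym (atʳ b)) (trans (sym eq) (atˡ a))) (v∈cone b)))
    ... | right b | left a   = ⊥-elim (v∉D a
          (subst (v ∈_) (trans (sym (atʳ b)) (trans eq (atˡ a))) (v∈cone b)))
    ... | right b | right b′ = cong (D.size ↑ʳ_) (L.injective b b′ (⊆-antisym
          (∪⁅x⁆-cancel-⊆ (v∉L b)  (⊆-reflexive cone≡))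
          (∪⁅x⁆-cancel-⊆ (v∉L b′) (⊆-reflexive (sym cone≡)))))
      where
      cone≡ : cone b ≡ cone b′
      cone≡ = trans (sym (atʳ b)) (trans eq (atʳ b′))

    facets-complete : ∀ F → IsFacet Δ F → ∃[ i ] facets i ≡ F
    facets-complete F (fF , max) with v ∈? F
    ... | no v∉F with D.complete F ((fF , ∉⇒Empty-∩ v∉F) , λ H (fH , _) → max H fH)
    ...   | a , eq = a ↑ˡ L.size , trans (atˡ a) eq
    facets-complete F (fF , max) | yes v∈F
      with L.complete (F - v) ((∉⇒Empty-∩ (x∉p-x F) , subst (Face Δ) (sym F-v∪v) fF) , max′)
      where
      F-v∪v = x∈p⇒p-x∪⁅x⁆≡p v∈F
      max′ : ∀ H → Face (link Δ ⁅ v ⁆) H → F - v ⊆ H → F - v ≡ H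
      max′ H (e , fHv) F-v⊆H = ⊆-antisym F-v⊆H λ {x} x∈H → x∈p∧x≢y⇒x∈p-y
        (subst (x ∈_) (sym F≡Hv) (p⊆p∪q ⁅ v ⁆ x∈H)) λ { refl → Empty-∩⇒∉ e x∈H }
        where
        F≡Hv : F ≡ H ∪ ⁅ v ⁆
        F≡Hv = max (H ∪ ⁅ v ⁆) fHv (subst (_⊆ H ∪ ⁅ v ⁆) F-v∪v (∪-monoˡ-⊆ ⁅ v ⁆ F-v⊆H))
    ... | b , eq = D.size ↑ʳ b , trans (atʳ b) (trans (cong (_∪ ⁅ v ⁆) eq) (x∈p⇒p-x∪⁅x⁆≡p v∈F))

    Shelled : (i j : Fin (D.size + L.size)) → Set
    Shelled i j = ∃[ u ] ∃[ ℓ ] (u ∈ facets j × u ∉ facets i × ℓ Fin.< j ×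
                                 facets j ─ facets ℓ ≡ ⁅ u ⁆)

    shelled-left : ∀ a a′ → a Fin.< a′ → Shelled (a ↑ˡ L.size) (a′ ↑ˡ L.size)
    shelled-left a a′ a<a′ with D.shelling a a′ a<a′
    ... | u , c , u∈ , u∉ , c<a′ , eq = u , c ↑ˡ L.size
      , subst (u ∈_) (sym (atˡ a′)) u∈
      , u∉ ∘ subst (u ∈_) (atˡ a)
      , subst₂ _<_ (sym (Fin.toℕ-↑ˡ c L.size)) (sym (Fin.toℕ-↑ˡ a′ L.size)) c<a′
      , trans (cong₂ _─_ (atˡ a′) (atˡ c)) eq

    shelled-right : ∀ b b′ → b Fin.< b′ → Shelled (D.size ↑ʳ b) (D.size ↑ʳ b′)
    shelled-right b b′ b<b′ with L.shelling b b′ b<b′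
    ... | u , c , u∈ , u∉ , c<b′ , eq = u , D.size ↑ʳ c
      , subst (u ∈_) (sym (atʳ b′)) (p⊆p∪q ⁅ v ⁆ u∈)
      , u∉cone ∘ subst (u ∈_) (atʳ b)
      , subst₂ _<_ (sym (Fin.toℕ-↑ʳ D.size c)) (sym (Fin.toℕ-↑ʳ D.size b′))
          (+-monoʳ-< D.size c<b′)
      , trans (cong₂ _─_ (atʳ b′) (atʳ c)) (trans (∪⁅x⁆-─-cancel (v∉L b′)) eq)
      where
      u∉cone : u ∉ cone b
      u∉cone u∈c with x∈p∪⁅y⁆⁻ (L.facet b) u∈c
      ... | inj₁ u∈b  = u∉ u∈b
      ... | inj₂ refl = v∉L b′ u∈

    -- Exchanging `v` in `cone b` gives a face of the deletion, and a facet of the deletion above it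
    -- comes earlier in the list. That facet contains all of `cone b` except `v`, so it serves as
    -- the predecessor for every `a`.
    shelled-cross : ∀ a b → Shelled (a ↑ˡ L.size) (D.size ↑ʳ b)
    shelled-cross a b
      with exchange {Δ = Δ} shedding (proj₁ (cone-facet b)) (v∈cone b)
    ... | w , w∉ , fH
      with facet-above (Δ ∖ ⁅ v ⁆) ((cone b ∪ ⁅ w ⁆) - v) (fH , ∉⇒Empty-∩ (x∉p-x (cone b ∪ ⁅ w ⁆)))
    ...   | F , H⊆F , facetF with D.complete F facetF
    ...     | c , refl = v , c ↑ˡ L.size
      , subst (v ∈_) (sym (atʳ b)) (v∈cone b)
      , v∉D a ∘ subst (v ∈_) (atˡ a)
      , ↑ˡ<↑ʳ c b
      , trans (cong₂ _─_ (atʳ b) (atˡ c)) (⊆-antisym l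
          (x∈p⇒⁅x⁆⊆p (x∈p∧x∉q⇒x∈p─q (v∈cone b) (v∉D c))))
      where
      l : cone b ─ D.facet c ⊆ ⁅ v ⁆
      l {x} x∈ = decidable-stable (x ∈? ⁅ v ⁆) λ x∉v →
        x∈p─q⇒x∉q (cone b) (D.facet c) x∈ (H⊆F (x∈p∧x≢y⇒x∈p-y
          (p⊆p∪q ⁅ w ⁆ (p─q⊆p (cone b) (D.facet c) x∈)) (x∉⁅y⁆⇒x≢y x∉v)))

    facets-shelled : ∀ i j → i Fin.< j → Shelled i j
    facets-shelled i j i<j with ↑view D.size i | ↑view D.size j
    ... | left a  | left a′  = shelled-left a a′
          (subst₂ _<_ (Fin.toℕ-↑ˡ a L.size) (Fin.toℕ-↑ˡ a′ L.size) i<j)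
    ... | left a  | right b  = shelled-cross a b
    ... | right b | left a   = ⊥-elim (<-asym i<j (↑ˡ<↑ʳ a b))
    ... | right b | right b′ = shelled-right b b′ (+-cancelˡ-< D.size _ _
          (subst₂ _<_ (Fin.toℕ-↑ʳ D.size b) (Fin.toℕ-↑ʳ D.size b′) i<j))

  shed-shellable : Shellable Δ
  shed-shellable = record
    { size      = D.size + L.size
    ; facet     = facets
    ; isFacet   = facets-facet
    ; injective = facets-injective
    ; complete  = facets-complete
    ; shelling  = facets-shelled
    }

vertexDecomposable⇒shellable : ∀ {Δ : SimplicialComplex n} →
                               VertexDecomposable Δ → Shellable Δ
vertexDecomposable⇒shellable (simplex s) = simplex⇒shellable s
vertexDecomposable⇒shellable (shed v sh del lk) = shed-shellable sh
  (vertexDecomposable⇒shellable del) (vertexDecomposable⇒shellable lk)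

-- A criterion for vertex decomposability

AgreeBelow : Fin n → Subset n → Subset n → Set
AgreeBelow v F A = ∀ i → i Fin.< v → i ∈ F ⇔ i ∈ A

-- Depending on A below v: either v is a cone point of the faces that agree
-- with A below v, or v can be exchanged for a later vertex in each of them.
OrderedExchange : SimplicialComplex n → Set
OrderedExchange Δ = ∀ v A →
    (∀ F → AgreeBelow v F A → Face Δ F → Face Δ (F ∪ ⁅ v ⁆))
  ⊎ (∀ F → AgreeBelow v F A → v ∈ F → Face Δ F →
       ∃[ w ] (v Fin.< w × w ∉ F × Face Δ ((F ∪ ⁅ w ⁆) - v)))

module _ {Δ : SimplicialComplex n} (exch : OrderedExchange Δ) where

  -- The state after the vertices below m have been treated: A consists of the
  -- linked vertices and the cone points, C of the cone points alone.
  record Reduces (m : ℕ) (A C : Subset n) (Θ : SimplicialComplex n) : Set where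
    field
      C⊆A   : C ⊆ A
      below : ∀ {i} → i ∈ A → toℕ i < m
      to    : ∀ {H} → Face Θ H → (∀ {i} → i ∈ H → i ∈ C ⊎ m ≤ toℕ i) × Face Δ (H ∪ A)
      from  : ∀ {H} → (∀ {i} → i ∈ H → i ∈ C ⊎ m ≤ toℕ i) → Face Δ (H ∪ A) → Face Θ H

  -- With no vertices left, a face can hold only cone points. Either `A` is a face of `Δ` and `Θ` is
  -- the simplex on `C`, or `Θ` has no faces at all.
  reduces-final : ∀ {A C Θ} → Reduces n A C Θ → IsSimplex Θ
  reduces-final {A} {C} {Θ} R with face? Δ A
  ... | no ¬fA = inj₁ λ H fH → ¬fA (down Δ (q⊆p∪q H A) (proj₂ (to fH)))
    where open Reduces R
  ... | yes fA = inj₂ (C , λ H → mk⇔ (H⊆C {H} ∘ proj₁ ∘ to) (simplex-face H))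
    where
    open Reduces R
    H⊆C : ∀ {H} → (∀ {i} → i ∈ H → i ∈ C ⊎ n ≤ toℕ i) → H ⊆ C
    H⊆C bound {i} i∈H with bound i∈H
    ... | inj₁ i∈C = i∈C
    ... | inj₂ n≤i = ⊥-elim (<-irrefl refl (≤-trans (Fin.toℕ<n i) n≤i))
    simplex-face : ∀ H → H ⊆ C → Face Θ H
    simplex-face H H⊆C = from (λ i∈H → inj₁ (H⊆C i∈H))
      (down Δ (∪-lub (⊆-trans H⊆C C⊆A) ⊆-refl) fA)

  module _ {A C : Subset n} {Θ : SimplicialComplex n} {v : Fin n} where

    private
      m = toℕ v

    module _ (R : Reduces m A C Θ) where
      open Reduces R

      private
        v∉A : v ∉ A
        v∉A v∈A = <-irrefl refl (below v∈A)

        below′ : ∀ {i} → i ∈ A → toℕ i < suc m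
        below′ i∈A = m<n⇒m<1+n (below i∈A)

        below″ : ∀ {i} → i ∈ A ∪ ⁅ v ⁆ → toℕ i < suc m
        below″ i∈ with x∈p∪⁅y⁆⁻ A i∈
        ... | inj₁ i∈A  = below′ i∈A
        ... | inj₂ refl = n<1+n m

        weaken : ∀ {H} → (∀ {i} → i ∈ H → i ∈ C ⊎ suc m ≤ toℕ i) →
                 ∀ {i} → i ∈ H → i ∈ C ⊎ m ≤ toℕ i
        weaken bound i∈H with bound i∈H
        ... | inj₁ i∈C = inj₁ i∈C
        ... | inj₂ m<i = inj₂ (<⇒≤ m<i)

        strengthen : ∀ {H} → v ∉ H → (∀ {i} → i ∈ H → i ∈ C ⊎ m ≤ toℕ i) →
                     ∀ {i} → i ∈ H → i ∈ C ⊎ suc m ≤ toℕ i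
        strengthen v∉H bound i∈H with bound i∈H
        ... | inj₁ i∈C = inj₁ i∈C
        ... | inj₂ m≤i = inj₂ (≤∧≢⇒< m≤i λ eq →
                v∉H (subst (_∈ _) (sym (Fin.toℕ-injective eq)) i∈H))

        avoids : ∀ {H} → (∀ {i} → i ∈ H → i ∈ C ⊎ suc m ≤ toℕ i) → v ∉ H
        avoids bound v∈H with bound v∈H
        ... | inj₁ v∈C = v∉A (C⊆A v∈C)
        ... | inj₂ m<m = <-irrefl refl m<m

        -- Below `v`, a face of `Θ` holds only cone points, and these lie in `A`. Hence one answer
        -- of `exch` at `A` serves all faces of `Θ` at once.
        agree : ∀ {H} → (∀ {i} → i ∈ H → i ∈ C ⊎ m ≤ toℕ i) → AgreeBelow v (H ∪ A) A
        agree {H} bound i i<v = mk⇔ (λ i∈ → go (x∈p∪q⁻ H A i∈)) (q⊆p∪q H A)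
          where
          go : i ∈ H ⊎ i ∈ A → i ∈ A
          go (inj₂ i∈A) = i∈A
          go (inj₁ i∈H) with bound i∈H
          ... | inj₁ i∈C = C⊆A i∈C
          ... | inj₂ v≤i = ⊥-elim (<-irrefl refl (≤-trans i<v v≤i))

      -- A cone point is not shed, so `Θ` stays the same. Joining `v` to `A` keeps `H ∪ A` a face,
      -- and joining it to `C` keeps `v` allowed in faces at the next stage.
      reduces-cone : (∀ F → AgreeBelow v F A → Face Δ F → Face Δ (F ∪ ⁅ v ⁆)) →
                     Reduces (suc m) (A ∪ ⁅ v ⁆) (C ∪ ⁅ v ⁆) Θ
      reduces-cone cone = record
        { C⊆A   = ∪-monoˡ-⊆ ⁅ v ⁆ C⊆A
        ; below = below″
        ; to    = λ {H} fH → let (bound , f) = to fH in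
            up bound , subst (Face Δ) (∪-assoc H A ⁅ v ⁆) (cone (H ∪ A) (agree bound) f)
        ; from  = λ {H} bound f →
            from (lower bound) (down Δ (∪-lub (p⊆p∪q (A ∪ ⁅ v ⁆)) (q⊆p∪q H _ ∘ p⊆p∪q ⁅ v ⁆)) f)
        }
        where
        up : ∀ {H} → (∀ {i} → i ∈ H → i ∈ C ⊎ m ≤ toℕ i) →
             ∀ {i} → i ∈ H → i ∈ C ∪ ⁅ v ⁆ ⊎ suc m ≤ toℕ i
        up bound {i} i∈H with bound i∈H | i Fin.≟ v
        ... | inj₁ i∈C | _        = inj₁ (p⊆p∪q ⁅ v ⁆ i∈C)
        ... | inj₂ _   | yes refl = inj₁ (x∈p∪⁅x⁆ C)
        ... | inj₂ m≤i | no i≢v   = inj₂ (≤∧≢⇒< m≤i (i≢v ∘ sym ∘ Fin.toℕ-injective))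

        lower : ∀ {H} → (∀ {i} → i ∈ H → i ∈ C ∪ ⁅ v ⁆ ⊎ suc m ≤ toℕ i) →
                ∀ {i} → i ∈ H → i ∈ C ⊎ m ≤ toℕ i
        lower bound i∈H with bound i∈H
        ... | inj₂ m<i = inj₂ (<⇒≤ m<i)
        ... | inj₁ i∈Cv with x∈p∪⁅y⁆⁻ C i∈Cv
        ...   | inj₁ i∈C  = inj₁ i∈C
        ...   | inj₂ refl = inj₂ ≤-refl

      -- Here `v` is not a vertex of `Θ`: a face through it would make `A ∪ ⁅ v ⁆` a face of `Δ`.
      reduces-skip : ¬ Face Δ (A ∪ ⁅ v ⁆) → Reduces (suc m) A C Θ
      reduces-skip ¬f = record
        { C⊆A   = C⊆A
        ; below = below′
        ; to    = λ {H} fH → let (bound , f) = to fH in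
            strengthen (λ v∈H → ¬f (down Δ
              (∪-lub (q⊆p∪q H A) (p⊆p∪q A ∘ x∈p⇒⁅x⁆⊆p v∈H)) f)) bound , f
        ; from  = λ bound → from (weaken bound)
        }

      reduces-deletion : Reduces (suc m) A C (Θ ∖ ⁅ v ⁆)
      reduces-deletion = record
        { C⊆A   = C⊆A
        ; below = below′
        ; to    = λ (fH , e) → let (bound , f) = to fH in strengthen (Empty-∩⇒∉ e) bound , f
        ; from  = λ bound f → from (weaken bound) f , ∉⇒Empty-∩ (avoids bound)
        }

      -- The linked vertex joins `A` but not `C`, since faces of the link avoid it.
      reduces-link : Reduces (suc m) (A ∪ ⁅ v ⁆) C (link Θ ⁅ v ⁆)
      reduces-link = record
        { C⊆A   = ⊆-trans C⊆A (p⊆p∪q ⁅ v ⁆)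
        ; below = below″
        ; to    = λ {H} (e , fH) → let (bound , f) = to fH in
            strengthen (Empty-∩⇒∉ e) (λ i∈H → bound (p⊆p∪q ⁅ v ⁆ i∈H)) , subst (Face Δ) (swap H) f
        ; from  = λ {H} bound f → ∉⇒Empty-∩ (avoids bound) ,
            from (with-v bound) (subst (Face Δ) (sym (swap H)) f)
        }
        where
        swap : ∀ H → (H ∪ ⁅ v ⁆) ∪ A ≡ H ∪ (A ∪ ⁅ v ⁆)
        swap H = trans (∪-assoc H ⁅ v ⁆ A) (cong (H ∪_) (∪-comm ⁅ v ⁆ A))

        with-v : ∀ {H} → (∀ {i} → i ∈ H → i ∈ C ⊎ suc m ≤ toℕ i) →
                 ∀ {i} → i ∈ H ∪ ⁅ v ⁆ → i ∈ C ⊎ m ≤ toℕ i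
        with-v {H} bound i∈ with x∈p∪⁅y⁆⁻ H i∈
        ... | inj₁ i∈H  = weaken bound i∈H
        ... | inj₂ refl = inj₂ ≤-refl

      -- The exchange is made in `Δ` for `τ ∪ A` and then restricted to `τ`. As `w` comes after `v`,
      -- it is still untreated, so the new set respects the bound on faces of `Θ`; as `v ∉ A`,
      -- removing `v` leaves `A` intact.
      reduces-shedding : Face Δ (A ∪ ⁅ v ⁆) →
        (∀ F → AgreeBelow v F A → v ∈ F → Face Δ F →
           ∃[ w ] (v Fin.< w × w ∉ F × Face Δ ((F ∪ ⁅ w ⁆) - v))) →
        IsSheddingFace Θ ⁅ v ⁆
      reduces-shedding fAv exchangeable =
        from (λ i∈v → inj₂ (≤-reflexive (sym (cong toℕ (x∈⁅y⁆⇒x≡y v i∈v)))))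
             (subst (Face Δ) (∪-comm A ⁅ v ⁆) fAv) ,
        λ { τ fτ v⊆τ u u∈v → subst (λ u → ∃[ w ] (w ∉ τ × Face Θ ((τ ∪ ⁅ w ⁆) - u)))
              (sym (x∈⁅y⁆⇒x≡y v u∈v)) (swapped τ fτ (v⊆τ (x∈⁅x⁆ v))) }
        where
        swapped : ∀ τ → Face Θ τ → v ∈ τ → ∃[ w ] (w ∉ τ × Face Θ ((τ ∪ ⁅ w ⁆) - v))
        swapped τ fτ v∈τ with to fτ
        ... | bound , f with exchangeable (τ ∪ A) (agree bound) (p⊆p∪q A v∈τ) f
        ...   | w , v<w , w∉ , f′ = w , w∉ ∘ p⊆p∪q A , from bound′ (down Δ sub f′)
          where
          bound′ : ∀ {i} → i ∈ (τ ∪ ⁅ w ⁆) - v → i ∈ C ⊎ m ≤ toℕ i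
          bound′ i∈ with x∈p∪⁅y⁆⁻ τ (p─q⊆p (τ ∪ ⁅ w ⁆) ⁅ v ⁆ i∈)
          ... | inj₁ i∈τ  = bound i∈τ
          ... | inj₂ refl = inj₂ (<⇒≤ v<w)

          sub : ((τ ∪ ⁅ w ⁆) - v) ∪ A ⊆ ((τ ∪ A) ∪ ⁅ w ⁆) - v
          sub {i} i∈ with x∈p∪q⁻ ((τ ∪ ⁅ w ⁆) - v) A i∈
          ... | inj₂ i∈A = x∈p∧x≢y⇒x∈p-y (p⊆p∪q ⁅ w ⁆ (q⊆p∪q τ A i∈A)) λ { refl → v∉A i∈A }
          ... | inj₁ i∈τ with x∈p-y⁻ (τ ∪ ⁅ w ⁆) i∈τ
          ...   | i∈τw , i≢v = x∈p∧x≢y⇒x∈p-y (∪-monoˡ-⊆ ⁅ w ⁆ (p⊆p∪q A) i∈τw) i≢v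

  -- Induction on `d`, the number of vertices still to be treated. The next one is handed to `treat`
  -- as an element `v` of `Fin n`, so that the stage is literally `toℕ v`.
  reduces⇒vertexDecomposable : ∀ d {m A C Θ} → m + d ≡ n → Reduces m A C Θ →
                               VertexDecomposable Θ
  treat : ∀ d v {A C Θ} → suc (toℕ v) + d ≡ n → Reduces (toℕ v) A C Θ →
          VertexDecomposable Θ

  reduces⇒vertexDecomposable zero {m} {A} {C} {Θ} eq R =
    simplex (reduces-final (subst (λ m → Reduces m A C Θ) (trans (sym (+-identityʳ m)) eq) R))
  reduces⇒vertexDecomposable (suc d) {m} {A} {C} {Θ} eq R =
    treat d (fromℕ< m<n)
      (trans (cong (λ k → suc k + d) toℕ-v) (trans (sym (+-suc m d)) eq))
      (subst (λ m → Reduces m A C Θ) (sym toℕ-v) R)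
    where
    m<n : m < n
    m<n = subst (m <_) eq (m<m+n m z<s)
    toℕ-v : toℕ (fromℕ< m<n) ≡ m
    toℕ-v = Fin.toℕ-fromℕ< m<n

  treat d v {A} eq R with exch v A | face? Δ (A ∪ ⁅ v ⁆)
  ... | inj₁ cone         | _      = reduces⇒vertexDecomposable d eq (reduces-cone R cone)
  ... | inj₂ _            | no ¬f  = reduces⇒vertexDecomposable d eq (reduces-skip R ¬f)
  ... | inj₂ exchangeable | yes f  = shed v (reduces-shedding R f exchangeable)
    (reduces⇒vertexDecomposable d eq (reduces-deletion R))
    (reduces⇒vertexDecomposable d eq (reduces-link R))

  orderedExchange⇒vertexDecomposable : VertexDecomposable Δ
  orderedExchange⇒vertexDecomposable = reduces⇒vertexDecomposable n {0} {⊥} {⊥} refl record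
    { C⊆A   = ⊆-refl
    ; below = λ i∈⊥ → ⊥-elim (∉⊥ i∈⊥)
    ; to    = λ {H} fH → (λ _ → inj₂ z≤n) , subst (Face Δ) (sym (∪-identityʳ H)) fH
    ; from  = λ {H} _ → subst (Face Δ) (∪-identityʳ H)
    }

-- Clique-free complexes of whiskerings

-- Faces exclude cliques of exactly `t` vertices, and a larger clique can be cut down to one of
-- these.
CF-bound : ∀ {t} (G : SimpleGraph n) {F S} → Face (CF t G) F → S ⊆ F → IsClique G S → ∣ S ∣ < t
CF-bound {t = t} G {F} {S} ¬clique S⊆F clique = ≰⇒> λ t≤∣S∣ →
  let (K , K⊆S , ∣K∣≡t) = shrink S t≤∣S∣ in
  ¬clique (K , S⊆F ∘ K⊆S , (λ u v u∈K v∈K → clique u v (K⊆S u∈K) (K⊆S v∈K)) , ∣K∣≡t)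

-- Here t stands for the paper's t − 1, the number of new vertices per block.
module _ {n : ℕ} (G : SimpleGraph n) {p : ℕ} (Π : CliquePartition G p) (t : ℕ) where
  open CliquePartition Π

  private
    N = n + p * t
    G′ = whiskering G Π (suc t)
    Γ = CF (suc t) G′

    vertex : Fin N → WhiskerVertex G Π (suc t)
    vertex = whiskerVertex G Π (suc t)

    index : WhiskerVertex G Π (suc t) → Fin N
    index (inj₁ u)       = u ↑ˡ (p * t)
    index (inj₂ (i , a)) = n ↑ʳ Fin.combine i a

    index-vertex : ∀ x → index (vertex x) ≡ x
    index-vertex x with splitAt n x in eq
    ... | inj₁ u = Fin.splitAt⁻¹-↑ˡ eq
    ... | inj₂ y = trans (cong (n ↑ʳ_) (Fin.combine-remQuot {p} t y)) (Fin.splitAt⁻¹-↑ʳ eq)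

    vertex-index : ∀ z → vertex (index z) ≡ z
    vertex-index (inj₁ u) rewrite Fin.splitAt-↑ˡ n u (p * t) = refl
    vertex-index (inj₂ (i , a))
      rewrite Fin.splitAt-↑ʳ n (p * t) (Fin.combine i a) | Fin.remQuot-combine i a = refl

    vertex-injective : ∀ {x y} → vertex x ≡ vertex y → x ≡ y
    vertex-injective {x} {y} eq =
      trans (sym (index-vertex x)) (trans (cong index eq) (index-vertex y))

    -- The order of `Fin N` is the order of treatment, so every new vertex is a later candidate for
    -- exchanging an original one.
    old<new : ∀ u i a → index (inj₁ u) Fin.< index (inj₂ (i , a))
    old<new u i a = ↑ˡ<↑ʳ u (Fin.combine i a)

    InBlock : Fin p → WhiskerVertex G Π (suc t) → Set
    InBlock i (inj₁ u)       = u ∈ block i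
    InBlock i (inj₂ (j , _)) = j ≡ i

    inBlock? : ∀ i z → Dec (InBlock i z)
    inBlock? i (inj₁ u)       = u ∈? block i
    inBlock? i (inj₂ (j , _)) = j Fin.≟ i

    whiskerBlock : Fin p → Subset N
    whiskerBlock i = subset (λ x → inBlock? i (vertex x))

    ∈-whiskerBlock⁺ : ∀ i x → InBlock i (vertex x) → x ∈ whiskerBlock i
    ∈-whiskerBlock⁺ i x = ∈-subset⁺ (λ x → inBlock? i (vertex x))

    ∈-whiskerBlock⁻ : ∀ i x → x ∈ whiskerBlock i → InBlock i (vertex x)
    ∈-whiskerBlock⁻ i x = ∈-subset⁻ (λ x → inBlock? i (vertex x))

    inBlock-adj : ∀ i y z → InBlock i y → InBlock i z → y ≢ z → WhiskerAdj G Π (suc t) y z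
    inBlock-adj i (inj₁ u)       (inj₁ v)       u∈ v∈ y≢z = clique i u v u∈ v∈ (y≢z ∘ cong inj₁)
    inBlock-adj i (inj₁ u)       (inj₂ (_ , _)) u∈ refl _ = u∈
    inBlock-adj i (inj₂ (_ , _)) (inj₁ v)       refl v∈ _ = v∈
    inBlock-adj i (inj₂ (_ , a)) (inj₂ (_ , b)) refl refl y≢z =
      refl , λ { refl → y≢z refl }

    whiskerBlock-clique : ∀ {i K} → K ⊆ whiskerBlock i → IsClique G′ K
    whiskerBlock-clique {i} K⊆ x y x∈K y∈K x≢y = inBlock-adj i (vertex x) (vertex y)
      (∈-whiskerBlock⁻ i x (K⊆ x∈K)) (∈-whiskerBlock⁻ i y (K⊆ y∈K)) (x≢y ∘ vertex-injective)

    adj-new : ∀ i a z → WhiskerAdj G Π (suc t) z (inj₂ (i , a)) → InBlock i z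
    adj-new i a (inj₁ u)       u∈       = u∈
    adj-new i a (inj₂ (j , b)) (eq , _) = eq

    -- All neighbours of a new vertex lie in its own whiskered block.
    clique-through-new : ∀ {i a x K} → vertex x ≡ inj₂ (i , a) → IsClique G′ K → x ∈ K →
                         K ⊆ whiskerBlock i
    clique-through-new {i} {a} {x} eq K-clique x∈K {y} y∈K = ∈-whiskerBlock⁺ i y (go (y Fin.≟ x))
      where
      go : Dec (y ≡ x) → InBlock i (vertex y)
      go (yes refl) = subst (InBlock i) (sym eq) refl
      go (no  y≢x)  = adj-new i a (vertex y)
        (subst (WhiskerAdj G Π (suc t) (vertex y)) eq (K-clique y x y∈K x∈K y≢x))

    -- Exchanges within a block

    exchange-new : ∀ {F v w i a} → Face Γ F → v ∈ F → w ∉ F → v ∈ whiskerBlock i →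
                   vertex w ≡ inj₂ (i , a) → Face Γ ((F ∪ ⁅ w ⁆) - v)
    exchange-new {F} {v} {w} {i} fF v∈F w∉F v∈B eq (K , K⊆ , K-clique , ∣K∣≡t) with w ∈? K
    ... | no w∉K = fF (K , K⊆F , K-clique , ∣K∣≡t)
      where
      K⊆F : K ⊆ F
      K⊆F x∈K with x∈p∪⁅y⁆⁻ F (p─q⊆p (F ∪ ⁅ w ⁆) ⁅ v ⁆ (K⊆ x∈K))
      ... | inj₁ x∈F  = x∈F
      ... | inj₂ refl = ⊥-elim (w∉K x∈K)
    -- A clique through `w` stays in the block. There `w` enters the trace `S` of `F` and `v` leaves
    -- it, so at most `t` vertices remain, too few for `K`.
    ... | yes w∈K = <-irrefl ∣K∣≡t (begin-strict
      ∣ K ∣               ≤⟨ p⊆q⇒∣p∣≤∣q∣ K⊆S ⟩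
      ∣ (S ∪ ⁅ w ⁆) - v ∣ <⟨ x∈p⇒∣p-x∣<∣p∣ (p⊆p∪q ⁅ w ⁆ (x∈p∩q⁺ (v∈F , v∈B))) ⟩
      ∣ S ∪ ⁅ w ⁆ ∣       ≤⟨ ∣p∪⁅x⁆∣≤1+∣p∣ S w ⟩
      suc ∣ S ∣           ≤⟨ CF-bound G′ fF (p∩q⊆p F _) (whiskerBlock-clique (p∩q⊆q F _)) ⟩
      suc t               ∎)
      where
      open ≤-Reasoning
      S = F ∩ whiskerBlock i
      K⊆S : K ⊆ (S ∪ ⁅ w ⁆) - v
      K⊆S x∈K with x∈p-y⁻ (F ∪ ⁅ w ⁆) (K⊆ x∈K)
      ... | x∈Fw , x≢v with x∈p∪⁅y⁆⁻ F x∈Fw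
      ...   | inj₁ x∈F  = x∈p∧x≢y⇒x∈p-y (p⊆p∪q ⁅ w ⁆
                (x∈p∩q⁺ (x∈F , clique-through-new eq K-clique w∈K x∈K))) x≢v
      ...   | inj₂ refl = x∈p∧x≢y⇒x∈p-y (x∈p∪⁅x⁆ S) x≢v

    -- Otherwise the `t` new vertices of the block, together with `v`, which is none of them, would
    -- form a clique of `suc t` vertices in `F`.
    missing-new : ∀ {F v i} → Face Γ F → v ∈ F → v ∈ whiskerBlock i →
                  (∀ a → v ≢ index (inj₂ (i , a))) → ∃[ a ] index (inj₂ (i , a)) ∉ F
    missing-new {F} {v} {i} fF v∈F v∈B v-old
      with any? (λ a → ¬? (index (inj₂ (i , a)) ∈? F))
    ... | yes found = found
    ... | no  none  = ⊥-elim (<-irrefl refl (begin-strict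
      t         ≤⟨ injection⇒≤∣p∣ (S - v) (λ a → index (inj₂ (i , a))) inj in-S ⟩
      ∣ S - v ∣ <⟨ x∈p⇒∣p-x∣<∣p∣ (x∈p∩q⁺ (v∈F , v∈B)) ⟩
      ∣ S ∣     ≤⟨ ≤-pred (CF-bound G′ fF (p∩q⊆p F _) (whiskerBlock-clique (p∩q⊆q F _))) ⟩
      t         ∎))
      where
      open ≤-Reasoning
      S = F ∩ whiskerBlock i
      inj : ∀ a b → index (inj₂ (i , a)) ≡ index (inj₂ (i , b)) → a ≡ b
      inj a b eq = Fin.combine-injectiveʳ i a i b (Fin.↑ʳ-injective n _ _ eq)
      in-S : ∀ a → index (inj₂ (i , a)) ∈ S - v
      in-S a = x∈p∧x≢y⇒x∈p-y (x∈p∩q⁺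
        ( decidable-stable (index (inj₂ (i , a)) ∈? F) (λ ∉F → none (a , ∉F))
        , ∈-whiskerBlock⁺ i _ (subst (InBlock i) (sym (vertex-index (inj₂ (i , a)))) refl)))
        (v-old a ∘ sym)

    module New (v : Fin N) (A : Subset N) (i : Fin p) (b : Fin t)
               (v-new : vertex v ≡ inj₂ (i , b)) where

      -- The elements of A below v, together with everything from v on, inside
      -- the block of v: the largest trace on it of a face agreeing with A below v.
      Trace : Fin N → Set
      Trace x = x ∈ whiskerBlock i × (x Fin.< v → x ∈ A)

      trace? : U.Decidable Trace
      trace? x = (x ∈? whiskerBlock i) ×-dec ((x Fin.<? v) →-dec (x ∈? A))

      trace : Subset N
      trace = subset trace?

      v∈B : v ∈ whiskerBlock i
      v∈B = ∈-whiskerBlock⁺ i v (subst (InBlock i) (sym v-new) refl)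

      -- A forbidden clique that avoids `v` would already lie in `F`. One through `v` stays in the
      -- block and agrees with `A` below `v`, hence lies in `trace`, which is too small.
      cone : ∣ trace ∣ < suc t → ∀ F → AgreeBelow v F A → Face Γ F → Face Γ (F ∪ ⁅ v ⁆)
      cone small F agree fF (K , K⊆ , K-clique , ∣K∣≡t) with v ∈? K
      ... | no v∉K = fF (K , K⊆F , K-clique , ∣K∣≡t)
        where
        K⊆F : K ⊆ F
        K⊆F x∈K with x∈p∪⁅y⁆⁻ F (K⊆ x∈K)
        ... | inj₁ x∈F  = x∈F
        ... | inj₂ refl = ⊥-elim (v∉K x∈K)
      ... | yes v∈K = <-irrefl ∣K∣≡t (≤-trans (s≤s (p⊆q⇒∣p∣≤∣q∣ K⊆trace)) small)
        where
        K⊆trace : K ⊆ trace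
        K⊆trace {x} x∈K = ∈-subset⁺ trace?
          (clique-through-new v-new K-clique v∈K x∈K , λ x<v → in-A x<v (x∈p∪⁅y⁆⁻ F (K⊆ x∈K)))
          where
          in-A : x Fin.< v → x ∈ F ⊎ x ≡ v → x ∈ A
          in-A x<v (inj₁ x∈F)  = Equivalence.to (agree x x<v) x∈F
          in-A x<v (inj₂ refl) = ⊥-elim (<-irrefl refl x<v)

      -- The trace is a clique too large for `F` to contain, so some `w` in it is missing from `F`.
      -- It is not below `v`, where `F` agrees with `A`, and it is not `v` itself. Being later than
      -- the new vertex `v`, it cannot be original, so `exchange-new` applies.
      exchangeable : ¬ ∣ trace ∣ < suc t → ∀ F → AgreeBelow v F A → v ∈ F → Face Γ F →
                     ∃[ w ] (v Fin.< w × w ∉ F × Face Γ ((F ∪ ⁅ w ⁆) - v))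
      exchangeable large F agree v∈F fF
        with any? (λ w → (w ∈? trace) ×-dec ¬? (w ∈? F))
      ... | no none = ⊥-elim (large (CF-bound G′ fF trace⊆F
              (whiskerBlock-clique (proj₁ ∘ ∈-subset⁻ trace?))))
        where
        trace⊆F : trace ⊆ F
        trace⊆F {x} x∈ = decidable-stable (x ∈? F) λ x∉F → none (x , x∈ , x∉F)
      ... | yes (w , w∈ , w∉F) with ∈-subset⁻ trace? w∈
      ...   | w∈B , below = w , v<w , w∉F ,
              exchange-new fF v∈F w∉F v∈B (proj₂ (new (vertex w) refl (∈-whiskerBlock⁻ i w w∈B)))
        where
        w≮v : ¬ w Fin.< v
        w≮v w<v = w∉F (Equivalence.from (agree w w<v) (below w<v))
        v<w : v Fin.< w
        v<w = ≤∧≢⇒< (≮⇒≥ w≮v) λ e → w∉F (subst (_∈ F) (Fin.toℕ-injective e) v∈F)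
        new : ∀ z → vertex w ≡ z → InBlock i z → ∃[ c ] vertex w ≡ inj₂ (i , c)
        new (inj₂ (_ , c)) e refl = c , e
        new (inj₁ u)       e _    = ⊥-elim (w≮v (subst₂ Fin._<_
          (trans (cong index (sym e)) (index-vertex w))
          (trans (cong index (sym v-new)) (index-vertex v))
          (old<new u i b)))

    whiskering-exchange : OrderedExchange Γ
    whiskering-exchange v A with vertex v in eq
    ... | inj₂ (i , b) with ∣ New.trace v A i b eq ∣ ℕ.<? suc t
    ...   | yes small = inj₁ (New.cone v A i b eq small)
    ...   | no  large = inj₂ (New.exchangeable v A i b eq large)
    -- An original vertex is exchangeable whatever `A` is: the block that covers it always has a new
    -- vertex outside the face.
    whiskering-exchange v A | inj₁ u = inj₂ old
      where
      v≡ : index (inj₁ u) ≡ v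
      v≡ = trans (cong index (sym eq)) (index-vertex v)
      v<new : ∀ i a → v Fin.< index (inj₂ (i , a))
      v<new i a = subst (Fin._< index (inj₂ (i , a))) v≡ (old<new u i a)
      old : ∀ F → AgreeBelow v F A → v ∈ F → Face Γ F →
            ∃[ w ] (v Fin.< w × w ∉ F × Face Γ ((F ∪ ⁅ w ⁆) - v))
      old F _ v∈F fF with covers u
      ... | i , u∈i with ∈-whiskerBlock⁺ i v (subst (InBlock i) (sym eq) u∈i)
      ...   | v∈B with missing-new fF v∈F v∈B (λ a e → <-irrefl (cong toℕ e) (v<new i a))
      ...     | a , w∉F = index (inj₂ (i , a)) , v<new i a , w∉F ,
                exchange-new fF v∈F w∉F v∈B (vertex-index (inj₂ (i , a)))

  CF-whiskering-vertexDecomposable : VertexDecomposable (CF (suc t) (whiskering G Π (suc t)))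
  CF-whiskering-vertexDecomposable = orderedExchange⇒vertexDecomposable whiskering-exchange

theorem4p9 : ∀ {n : ℕ} (G : SimpleGraph n) {p : ℕ} (Π : CliquePartition G p)
    (t : ℕ) → 2 ≤ t →
    Decomposable (t ∸ 2) (CF t (whiskering G Π t)) ×
    Shellable (CF t (whiskering G Π t))
theorem4p9 G Π (suc t) _ =
  vertexDecomposable⇒decomposable (suc t ∸ 2) vd , vertexDecomposable⇒shellable vd
  where vd = CF-whiskering-vertexDecomposable G Π t
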